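{- Let $L$ be an oriented non-split alternating link and let $\overline A_B$ and $\overline A_W$ be the weighted adjacency matrices of its consolidated Tait graphs $G_B^*$ and $G_W^*$. Then $$CWR_5(L)=\bigl(\Phi_5(\overline A_B),\,\Phi_5(\overline A_W)\bigr),$$ where for a symmetric zero-diagonal matrix $M=(m_{ij})$ $$\Phi_5(M)=\frac1{10}\Bigl[\operatorname{tr}(M^5)-5\,\operatorname{tr}\bigl(\Delta(M)M^3\bigr)+5\,\operatorname{tr}\bigl(M^{\circ3}M^2\bigr)\Bigr].$$ Equivalently, in entries, $$\Phi_5(M)=\frac1{10}\left[\operatorname{tr}(M^5)-5\sum_i\Bigl(\sum_jm_{ij}^2\Bigr)(M^3)_{ii}+5\sum_{i,j}m_{ij}^3(M^2)_{ij}\right].$$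
   Context: $M^{\circ3}$ is the entrywise (Hadamard) cube of $M$, and $\Delta(M)$ is the diagonal matrix with $\Delta(M)_{ii}=\sum_jm_{ij}^2$. Tait graphs and $CWR$. Let $D$ be a reduced (no nugatory crossings) alternating diagram of an oriented non-split alternating link $L$. The regions of $D$ are checkerboard coloured black and white, so that regions sharing an edge have opposite colours; which class is called black is fixed once and for all by a local rule depending on the over/under pattern at crossings, the same rule for all diagrams (the statement holds for either choice of rule). The Tait graph $G_B$ has one vertex for each black region and one edge for each crossing, joining the black regions meeting at that crossing; $G_W$ is defined in the same way from white regions. Each edge $e$ gets weight $\operatorname{wg}(e)=w$ if the crossing is positive and $r$ if it is negative, where $w,r$ are commuting indeterminates. The consolidated Tait graph $G_B^*$ is the weighted simple graph obtained from $G_B$ by replacing all parallel edges joining the same pair of vertices by a single edge whose weight is the product of their weights; $G_W^*$ is obtained from $G_W$ likewise. For $i>2$, $CB_i(w,r)=\sum_C\prod_{e\in E(C)}\operatorname{wg}(e)$, summed over all unoriented simple cycles $C$ of length $i$ in $G_B^*$; $CW_i$ is defined analogously from $G_W^*$; and $CWR_i=(CB_i,CW_i)$. It is a known theorem that $CWR_i$ does not depend on the chosen reduced alternating diagram $D$ of $L$; $CWR_i(L)$ denotes the common value. The weighted adjacency matrix of a simple loopless weighted graph has $(i,j)$ entry equal to the weight of the edge $v_iv_j$ if it exists, and $0$ otherwise. -}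

module Defs where

open import Data.Bool.Base using (T; if_then_else_; _∧_)
open import Data.Bool.Properties using (T?)
open import Data.Empty using (⊥)
open import Data.Fin.Base as Fin using (Fin)
open import Data.Fin.Properties as Fin using (_≟_; _<?_)
open import Data.List.Base as List using (List; []; _∷_; _++_)
open import Data.List.Properties using (filter-≐; filter-none)
open import Data.List.Relation.Unary.All as ListAll using ()
import Data.List.Relation.Unary.All.Properties as ListAll
open import Data.Maybe.Base using (Maybe; just; nothing; is-just; fromMaybe)
open import Data.Nat.Base as ℕ using (ℕ; zero; suc; NonZero)
open import Data.Integer.Base as ℤ using (+_)
open import Data.Product.Base using (∃₂; _×_; _,_)
open import Data.Product.Relation.Binary.Pointwise.NonDependent using (Pointwise)
open import Data.Rational.Base as ℚ using (ℚ; 0ℚ; 1ℚ; _/_)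
open import Data.Sign.Base as Sign using (Sign)
open import Data.Sum.Base using (_⊎_; inj₁; inj₂; swap)
open import Data.Vec.Base as Vec using (Vec; []; _∷_)
import Data.Vec.Functional as Vector
open import Data.Vec.Relation.Unary.All as VecAll using (All)
open import Data.Vec.Relation.Unary.AllPairs as AllPairs using (AllPairs)
open import Function.Bundles using (_↔_; _⇔_; Inverse; Equivalence)
open import Relation.Binary.Construct.Closure.Equivalence using (EqClosure)
open import Relation.Binary.PropositionalEquality
  using (_≡_; _≢_; refl; cong; trans; sym)
open import Relation.Nullary using (¬_; Dec; yes; no; ¬?)
open import Relation.Nullary.Decidable using (_×-dec_; _⊎-dec_)
open import Relation.Unary using (Decidable)

------------------------------------------------------------------------
-- The polynomial ring ℚ[w,r]

-- A polynomial is a formal finite sum of terms (c , a , b), read c wᵃ rᵇ;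
-- terms may repeat, so equality of polynomials is _≈_, not _≡_.

Term : Set
Term = ℚ × ℕ × ℕ

Poly : Set
Poly = List Term

coeff : Poly → ℕ → ℕ → ℚ
coeff []                 a b = 0ℚ
coeff ((c , i , j) ∷ p) a b =
  (if (i ℕ.≡ᵇ a) ∧ (j ℕ.≡ᵇ b) then c else 0ℚ) ℚ.+ coeff p a b

infix 4 _≈_
_≈_ : Poly → Poly → Set
p ≈ q = ∀ a b → coeff p a b ≡ coeff q a b

const : ℚ → Poly
const c = (c , 0 , 0) ∷ []

0ₚ 1ₚ w r : Poly
0ₚ = []
1ₚ = const 1ℚ
w  = (1ℚ , 1 , 0) ∷ []
r  = (1ℚ , 0 , 1) ∷ []

mulTerm : Term → Term → Term
mulTerm (c , a , b) (d , a′ , b′) = c ℚ.* d , a ℕ.+ a′ , b ℕ.+ b′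

infixl 6 _+_ _-_
infixl 7 _*_
infixr 8 _^_

_+_ _*_ _-_ : Poly → Poly → Poly
p + q = p ++ q
p * q = List.cartesianProductWith mulTerm p q
p - q = p + const (ℚ.- 1ℚ) * q

_^_ : Poly → ℕ → Poly
p ^ zero  = 1ₚ
p ^ suc k = p * p ^ k

∑ : ∀ {n} → (Fin n → Poly) → Poly
∑ = Vector.foldr _+_ 0ₚ

sumₚ productₚ : List Poly → Poly
sumₚ     = List.foldr _+_ 0ₚ
productₚ = List.foldr _*_ 1ₚ

------------------------------------------------------------------------
-- Square matrices over ℚ[w,r]

Matrix : ℕ → Set
Matrix n = Fin n → Fin n → Poly

Symmetric ZeroDiagonal : ∀ {n} → Matrix n → Set
Symmetric    M = ∀ i j → M i j ≈ M j i
ZeroDiagonal M = ∀ i → M i i ≈ 0ₚ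

𝟙 : ∀ {n} → Matrix n
𝟙 i j with i ≟ j
... | yes _ = 1ₚ
... | no  _ = 0ₚ

infixl 7 _·_
_·_ : ∀ {n} → Matrix n → Matrix n → Matrix n
(M · N) i j = ∑ λ k → M i k * N k j

infixr 8 _^ᴹ_
_^ᴹ_ : ∀ {n} → Matrix n → ℕ → Matrix n
M ^ᴹ zero  = 𝟙
M ^ᴹ suc k = M · M ^ᴹ k

tr : ∀ {n} → Matrix n → Poly
tr M = ∑ λ i → M i i

infix 9 _∘³
_∘³ : ∀ {n} → Matrix n → Matrix n
(M ∘³) i j = M i j ^ 3

Δ : ∀ {n} → Matrix n → Matrix n
Δ M i j with i ≟ j
... | yes _ = ∑ λ k → M i k ^ 2
... | no  _ = 0ₚ

five tenth : Poly
five  = const (+ 5 / 1)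
tenth = const (+ 1 / 10)

Φ₅ : ∀ {n} → Matrix n → Poly
Φ₅ M = tenth * (tr (M ^ᴹ 5) - five * tr (Δ M · M ^ᴹ 3) + five * tr (M ∘³ · M ^ᴹ 2))

Φ₅-entries : ∀ {n} → Matrix n → Poly
Φ₅-entries M = tenth *
  ( tr (M ^ᴹ 5)
  - five * (∑ λ i → (∑ λ j → M i j ^ 2) * (M ^ᴹ 3) i i)
  + five * (∑ λ i → ∑ λ j → M i j ^ 3 * (M ^ᴹ 2) i j) )

------------------------------------------------------------------------
-- Weighted graphs

record WeightedMultigraph : Set where
  field
    order     : ℕ
    size      : ℕ
    end₁ end₂ : Fin size → Fin order
    wg        : Fin size → Poly

record WeightedGraph : Set where
  field
    order    : ℕ
    edge     : Fin order → Fin order → Maybe Poly   -- the weight, if there is an edge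
    edge-sym : ∀ u v → edge u v ≡ edge v u
    loopless : ∀ v → edge v v ≡ nothing

  Adjacent : Fin order → Fin order → Set
  Adjacent u v = T (is-just (edge u v))

  adjacencyMatrix : Matrix order
  adjacencyMatrix u v = fromMaybe 0ₚ (edge u v)

module _ (G : WeightedMultigraph) where
  open WeightedMultigraph G

  Loopless : Set
  Loopless = ∀ e → end₁ e ≢ end₂ e

  Joins : Fin order → Fin order → Fin size → Set
  Joins u v e = (end₁ e ≡ u × end₂ e ≡ v) ⊎ (end₁ e ≡ v × end₂ e ≡ u)

  joins? : ∀ u v → Decidable (Joins u v)
  joins? u v e = (end₁ e ≟ u ×-dec end₂ e ≟ v) ⊎-dec (end₁ e ≟ v ×-dec end₂ e ≟ u)

  edgesJoining : Fin order → Fin order → List (Fin size)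
  edgesJoining u v = List.filter (joins? u v) (List.allFin size)

  mergeParallel : List (Fin size) → Maybe Poly
  mergeParallel []         = nothing
  mergeParallel es@(_ ∷ _) = just (productₚ (List.map wg es))

  consolidate : Loopless → WeightedGraph
  consolidate noLoop = record
    { order    = order
    ; edge     = λ u v → mergeParallel (edgesJoining u v)
    ; edge-sym = λ u v → cong mergeParallel
        (filter-≐ (joins? u v) (joins? v u) (swap , swap) (List.allFin size))
    ; loopless = λ v → cong mergeParallel
        (filter-none (joins? v v) {List.allFin size} (ListAll.tabulate⁺ (notLoop v)))
    }
    where
    notLoop : ∀ v e → ¬ Joins v v e
    notLoop v e (inj₁ (p , q)) = noLoop e (trans p (sym q))
    notLoop v e (inj₂ (p , q)) = noLoop e (trans p (sym q))

------------------------------------------------------------------------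
-- Simple cycles in a weighted graph

module _ (G : WeightedGraph) where
  private
    module G = WeightedGraph G
    Vertex = Fin G.order

  -- The sides of the closed polygon with the given successive vertices.
  sidesTo : Vertex → ∀ {i} → Vec Vertex i → List (Vertex × Vertex)
  sidesTo v₀ []           = []
  sidesTo v₀ (u ∷ [])     = (u , v₀) ∷ []
  sidesTo v₀ (u ∷ v ∷ vs) = (u , v) ∷ sidesTo v₀ (v ∷ vs)

  sides : ∀ {i} → Vec Vertex i → List (Vertex × Vertex)
  sides []            = []
  sides vs@(v₀ ∷ _) = sidesTo v₀ vs

  -- An unoriented cycle of length i > 2 can be written as a sequence of
  -- vertices in 2i ways (i starting points, two directions).  Exactly one of
  -- them starts at the least vertex and has its second vertex smaller than its
  -- last, so these sequences represent each unoriented cycle once.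
  -- Lengths i ≤ 2 are excluded.
  Normalised : ∀ {i} → Vec Vertex i → Set
  Normalised (u ∷ v ∷ x ∷ vs) =
    All (u Fin.<_) (v ∷ x ∷ vs) × v Fin.< Vec.last (x ∷ vs)
  Normalised _ = ⊥

  IsCycle : ∀ {i} → Vec Vertex i → Set
  IsCycle vs = AllPairs _≢_ vs
             × ListAll.All (λ (u , v) → G.Adjacent u v) (sides vs)
             × Normalised vs

  normalised? : ∀ {i} → Decidable (Normalised {i})
  normalised? []                = no λ ()
  normalised? (_ ∷ [])          = no λ ()
  normalised? (_ ∷ _ ∷ [])      = no λ ()
  normalised? (u ∷ v ∷ x ∷ vs) =
    VecAll.all? (u <?_) (v ∷ x ∷ vs) ×-dec v <? Vec.last (x ∷ vs)

  isCycle? : ∀ {i} → Decidable (IsCycle {i})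
  isCycle? vs = AllPairs.allPairs? (λ u v → ¬? (u ≟ v)) vs
          ×-dec ListAll.all? (λ _ → T? _) (sides vs)
          ×-dec normalised? vs

  sequences : ∀ i → List (Vec Vertex i)
  sequences zero    = [] ∷ []
  sequences (suc i) = List.cartesianProductWith _∷_ (List.allFin G.order) (sequences i)

  cycles : ∀ i → List (Vec Vertex i)
  cycles i = List.filter isCycle? (sequences i)

  cycleWeight : ∀ {i} → Vec Vertex i → Poly
  cycleWeight vs = productₚ (List.map (λ (u , v) → fromMaybe 0ₚ (G.edge u v)) (sides vs))

  cyclePolynomial : ℕ → Poly
  cyclePolynomial i = sumₚ (List.map cycleWeight (cycles i))

------------------------------------------------------------------------
-- Oriented link diagrams

data Height : Set where
  over under : Height

flip : Height → Height
flip over  = under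
flip under = over

data Direction : Set where
  incoming outgoing : Direction

-- A signed Gauss code.  Each crossing is passed twice, once on the over-strand
-- and once on the under-strand; `follow` sends a passage to the next one along
-- the oriented link, so the link components are its cycles.
record GaussCode : Set where
  field
    crossings : ℕ
    sign      : Fin crossings → Sign
    follow    : (Fin crossings × Height) ↔ (Fin crossings × Height)

  Crossing : Set
  Crossing = Fin crossings

  HalfEdge : Set
  HalfEdge = Crossing × Height × Direction

  -- The other half of the same edge.
  opposite : HalfEdge → HalfEdge
  opposite (c , h , outgoing) = let (c′ , h′) = Inverse.to   follow (c , h) in c′ , h′ , incoming
  opposite (c , h , incoming) = let (c′ , h′) = Inverse.from follow (c , h) in c′ , h′ , outgoing

  -- The next half-edge counterclockwise around the crossing.  At a positive
  -- crossing the over-strand, turned counterclockwise by less than a straight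
  -- angle, matches the under-strand with its direction.
  rotate : HalfEdge → HalfEdge
  rotate (c , h , d) = c , flip h , turn (sign c) h d
    where
    turn : Sign → Height → Direction → Direction
    turn Sign.+ over  d        = d
    turn Sign.+ under incoming = outgoing
    turn Sign.+ under outgoing = incoming
    turn Sign.- under d        = d
    turn Sign.- over  incoming = outgoing
    turn Sign.- over  outgoing = incoming

  -- A half-edge x also names the corner between x and rotate x.  Walking from
  -- that corner along the edge of rotate x, with the edge on the left, one
  -- arrives at the corner nextCorner x of the same region.
  nextCorner : HalfEdge → HalfEdge
  nextCorner x = opposite (rotate x)

  SameRegion : HalfEdge → HalfEdge → Set
  SameRegion = EqClosure λ x y → nextCorner x ≡ y

  -- A code without crossings is read as a single crossingless circle.
  Connected : Set
  Connected = ∀ c c′ → EqClosure Linked c c′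
    where
    Linked : Crossing → Crossing → Set
    Linked c c′ = ∃₂ λ h h′ → Inverse.to follow (c , h) ≡ (c′ , h′)

  Alternating : Set
  Alternating = ∀ c h → let (_ , h′) = Inverse.to follow (c , h) in h′ ≡ flip h

  -- A crossing is nugatory when two opposite corners lie in one region: a
  -- circle through that region then meets the diagram at the crossing only.
  Reduced : Set
  Reduced = ∀ c h → ¬ SameRegion (c , h , incoming) (c , h , outgoing)

  -- The checkerboard colouring of an alternating diagram: the colour of the
  -- corner x is the height of x.  Corners separated by an edge at a crossing
  -- have different heights, and nextCorner preserves the height.  Thus the
  -- corners of colour `over` are those swept when the over-strand is turned
  -- counterclockwise onto the under-strand.  This numbers the regions of
  -- colour κ.
  record Regions (κ : Height) : Set where
    field
      count    : ℕ
      region   : Crossing → Direction → Fin count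
      region-≡ : ∀ {c d c′ d′} →
                 (region c d ≡ region c′ d′) ⇔ SameRegion (c , κ , d) (c′ , κ , d′)
      covered  : .{{NonZero crossings}} → ∀ v → ∃₂ λ c d → region c d ≡ v
      circle   : crossings ≡ 0 → count ≡ 1

-- A diagram of a non-split link is connected.  For a connected code Euler's
-- formula V − E + F = 2, with E = 2V, says that it is realised by a diagram on
-- the sphere.
record ReducedAlternatingDiagram : Set where
  field
    code : GaussCode
  open GaussCode code public
  field
    connected   : Connected
    alternating : Alternating
    regions     : ∀ κ → Regions κ
    planar      : Regions.count (regions over) ℕ.+ Regions.count (regions under) ≡ crossings ℕ.+ 2
    reduced     : Reduced

------------------------------------------------------------------------
-- Tait graphs and CWR

crossingWeight : Sign → Poly
crossingWeight Sign.+ = w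
crossingWeight Sign.- = r

module _ (D : ReducedAlternatingDiagram) where
  open ReducedAlternatingDiagram D

  taitGraph : Height → WeightedMultigraph
  taitGraph κ = record
    { order = count
    ; size  = crossings
    ; end₁  = λ c → region c incoming
    ; end₂  = λ c → region c outgoing
    ; wg    = λ c → crossingWeight (sign c)
    }
    where open Regions (regions κ)

  taitGraph-loopless : ∀ κ → Loopless (taitGraph κ)
  taitGraph-loopless κ c eq =
    reduced c κ (Equivalence.to (Regions.region-≡ (regions κ)) eq)

  taitGraph* : Height → WeightedGraph
  taitGraph* κ = consolidate (taitGraph κ) (taitGraph-loopless κ)

  -- The first argument is the colour called black.
  CWR : Height → ℕ → Poly × Poly
  CWR black i = cyclePolynomial (taitGraph* black) i
              , cyclePolynomial (taitGraph* (flip black)) i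

infix 4 _≈₂_
_≈₂_ : Poly × Poly → Poly × Poly → Set
_≈₂_ = Pointwise _≈_ _≈_

{-# OPTIONS --safe #-}
-- In a loopless weighted graph a closed walk of length five fails to be a cycle only if two of its
-- vertices at distance two along the walk coincide.  Of these five events, two that are not
-- neighbours force a loop, so inclusion–exclusion stops at neighbouring pairs: one event leaves a
-- triangle with a pendant edge, tr (Δ M · M³), and two leave a triangle with one edge traversed
-- three times, tr (M∘³ · M²).  The dihedral group of order ten acts on the remaining closed walks,
-- and exactly one walk in each orbit is normalised.
module Submission where

open import Algebra.Bundles using (CommutativeSemiring)
open import Algebra.Structures.Biased using (isCommutativeSemiringˡ)
open import Data.Bool.Base using (Bool; T; true; false; if_then_else_; not; _∧_)
open import Data.Bool.Properties using (T?)
open import Data.Fin.Base as Fin using (Fin; zero; suc)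
open import Data.Fin.Properties as Fin using (_≟_; _<?_)
open import Data.List.Base as List using (List; []; _∷_; _++_)
import Data.List.Extrema as Extrema
open import Data.List.Membership.Propositional using (_∈_)
open import Data.List.Properties using (++-assoc; map-++; map-cong; map-∘; cartesianProductWith-distribʳ-++; cartesianProductWith-zeroʳ)
open import Data.List.Relation.Unary.All as ListAll using ([]; _∷_)
open import Data.List.Relation.Unary.Any using (here; there)
open import Data.Maybe.Base using (just; nothing; is-just; fromMaybe)
open import Data.Nat.Base as ℕ using (ℕ; zero; suc)
import Data.Nat.Properties as ℕ
open import Data.Product.Base using (_×_; _,_)
open import Data.Rational.Base as ℚ using (ℚ; 0ℚ; 1ℚ)
import Data.Rational.Properties as ℚ
open import Data.Sum.Base using (_⊎_; inj₁; inj₂)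
open import Data.Vec.Base using (Vec; []; _∷_)
open import Data.Vec.Relation.Unary.All using ([]; _∷_)
open import Data.Vec.Relation.Unary.AllPairs using ([]; _∷_)
open import Function.Base using (_∘_; id)
open import Function.Bundles using (mk⇔)
open import Level using (0ℓ)
open import Relation.Binary.Bundles using (Setoid)
open import Relation.Binary.Definitions using (tri<; tri≈; tri>)
open import Relation.Binary.PropositionalEquality as ≡ using (_≡_; _≢_; ≢-sym)
import Relation.Binary.Reasoning.Setoid as SetoidReasoning
open import Relation.Binary.Structures using (IsEquivalence)
open import Relation.Nullary using (¬_; Dec; does; yes; no; ¬?; contradiction)
open import Relation.Nullary.Decidable using (_×-dec_; does-⇔)
open import Relation.Unary using (Pred; Decidable)

-- Closed walks of length five over a commutative semiring

-- Any three of the five coincidences include two that are not neighbours, so only the empty set,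
-- single events and neighbouring pairs survive. A single event does not yet isolate a triangle with
-- a separate pendant edge: the pendant edge may run along the triangle, and then two neighbouring
-- coincidences hold and the walk is counted twice; the pair term corrects this. The coefficient 5
-- counts the rotations of one event, and equally those of one neighbouring pair; 10 is five
-- starting points times two directions. Every restriction on walks is a 0-1 factor on the weight,
-- so all sums range over all 5-tuples and each symmetry becomes an exchange of summation order. The
-- counting identity has natural coefficients and is proved in an arbitrary commutative semiring;
-- elements playing the roles of -1 and 1/10 enter only when it is solved for the cycle sum.

Least : ∀ {n} → (a b c d e : Fin n) → Set
Least a b c d e = a Fin.< b × a Fin.< c × a Fin.< d × a Fin.< e

-- The ten pairs of positions split into the five sides of the pentagon (`Consecutive`) and its five
-- diagonals (`Spread`). Both list their inequalities in cyclic order, so that a rotation merely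
-- shifts the components.
Consecutive : ∀ {n} → (a b c d e : Fin n) → Set
Consecutive a b c d e = a ≢ b × b ≢ c × c ≢ d × d ≢ e × e ≢ a

Spread : ∀ {n} → (a b c d e : Fin n) → Set
Spread a b c d e = a ≢ c × b ≢ d × c ≢ e × d ≢ a × e ≢ b

least? : ∀ {n} (a b c d e : Fin n) → Dec (Least a b c d e)
least? a b c d e = a <? b ×-dec a <? c ×-dec a <? d ×-dec a <? e

consecutive? : ∀ {n} (a b c d e : Fin n) → Dec (Consecutive a b c d e)
consecutive? a b c d e =
  ¬? (a ≟ b) ×-dec ¬? (b ≟ c) ×-dec ¬? (c ≟ d) ×-dec ¬? (d ≟ e) ×-dec ¬? (e ≟ a)

spread? : ∀ {n} (a b c d e : Fin n) → Dec (Spread a b c d e)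
spread? a b c d e =
  ¬? (a ≟ c) ×-dec ¬? (b ≟ d) ×-dec ¬? (c ≟ e) ×-dec ¬? (d ≟ a) ×-dec ¬? (e ≟ b)

rotate-consecutive : ∀ {n} {a b c d e : Fin n} → Consecutive a b c d e → Consecutive b c d e a
rotate-consecutive (ab , bc , cd , de , ea) = bc , cd , de , ea , ab

rotate-spread : ∀ {n} {a b c d e : Fin n} → Spread a b c d e → Spread b c d e a
rotate-spread (ac , bd , ce , da , eb) = bd , ce , da , eb , ac

reflect-spread : ∀ {n} {a b c d e : Fin n} → Spread a b c d e → Spread a e d c b
reflect-spread (ac , bd , ce , da , eb) = ≢-sym da , ≢-sym ce , ≢-sym bd , ≢-sym ac , ≢-sym eb

reflect-least : ∀ {n} {a b c d e : Fin n} → Least a b c d e → Least a e d c b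
reflect-least (ab , ac , ad , ae) = ae , ad , ac , ab

least-intro : ∀ {n} {a b c d e : Fin n} → Consecutive a b c d e → Spread a b c d e →
  a Fin.≤ b → a Fin.≤ c → a Fin.≤ d → a Fin.≤ e → Least a b c d e
least-intro (ab , _ , _ , _ , ea) (ac , _ , _ , da , _) a≤b a≤c a≤d a≤e =
  Fin.≤∧≢⇒< a≤b ab , Fin.≤∧≢⇒< a≤c ac , Fin.≤∧≢⇒< a≤d (≢-sym da) , Fin.≤∧≢⇒< a≤e (≢-sym ea)

-- The minimum is attained at one of the five positions, and distinctness makes it strict; the walk
-- is rotated to begin there.
some-least : ∀ {n} {a b c d e : Fin n} → Consecutive a b c d e → Spread a b c d e →
  Least a b c d e ⊎ Least b c d e a ⊎ Least c d e a b ⊎ Least d e a b c ⊎ Least e a b c d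
some-least {n} {a} {b} {c} {d} {e} cons spr = select min-sel (min≤⊤ a rest) (min≤xs a rest)
  where
  open Extrema (Fin.≤-totalOrder n) using (min; min≤⊤; min≤xs; argmin-sel)
  rest = b ∷ c ∷ d ∷ e ∷ []
  r = rotate-consecutive
  s = rotate-spread
  min-sel : min a rest ≡ a ⊎ min a rest ∈ rest
  min-sel = argmin-sel id a rest
  select : ∀ {m} → m ≡ a ⊎ m ∈ rest → m Fin.≤ a → ListAll.All (m Fin.≤_) rest →
    Least a b c d e ⊎ Least b c d e a ⊎ Least c d e a b ⊎ Least d e a b c ⊎ Least e a b c d
  select (inj₁ ≡.refl) ≤a (≤b ∷ ≤c ∷ ≤d ∷ ≤e ∷ []) =
    inj₁ (least-intro cons spr ≤b ≤c ≤d ≤e)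
  select (inj₂ (here ≡.refl)) ≤a (≤b ∷ ≤c ∷ ≤d ∷ ≤e ∷ []) =
    inj₂ (inj₁ (least-intro (r cons) (s spr) ≤c ≤d ≤e ≤a))
  select (inj₂ (there (here ≡.refl))) ≤a (≤b ∷ ≤c ∷ ≤d ∷ ≤e ∷ []) =
    inj₂ (inj₂ (inj₁ (least-intro (r (r cons)) (s (s spr)) ≤d ≤e ≤a ≤b)))
  select (inj₂ (there (there (here ≡.refl)))) ≤a (≤b ∷ ≤c ∷ ≤d ∷ ≤e ∷ []) =
    inj₂ (inj₂ (inj₂ (inj₁ (least-intro (r (r (r cons))) (s (s (s spr))) ≤e ≤a ≤b ≤c))))
  select (inj₂ (there (there (there (here ≡.refl))))) ≤a (≤b ∷ ≤c ∷ ≤d ∷ ≤e ∷ []) =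
    inj₂ (inj₂ (inj₂ (inj₂ (least-intro (r (r (r (r cons)))) (s (s (s (s spr)))) ≤a ≤b ≤c ≤d))))

module ClosedWalks {c ℓ} (R : CommutativeSemiring c ℓ) where
  open CommutativeSemiring R hiding (zero)
  open import Algebra.Properties.Semiring.Sum semiring
    using (sum; sum-cong-≋; ∑-distrib-+; ∑-comm; sum-replicate-zero; *-distribˡ-sum; *-distribʳ-sum)
  open import Algebra.Properties.Semiring.Mult semiring
    using (×-congʳ; ×-assoc-*) renaming (_×_ to _×ₙ_)
  open SetoidReasoning setoid
  open import Algebra.Solver.Ring.NaturalCoefficients.Default R

  -- The Iverson bracket. It reads only the `does` field, so it computes through `×-dec` and `¬?`
  -- and agrees on equivalent propositions.
  [_] : ∀ {p} {P : Set p} → Dec P → Carrier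
  [ P? ] = if does P? then 1# else 0#

  []-yes : ∀ {p} {P : Set p} (P? : Dec P) → P → [ P? ] ≈ 1#
  []-yes (yes _) _ = refl
  []-yes (no ¬p) p = contradiction p ¬p

  []-no : ∀ {p} {P : Set p} (P? : Dec P) → ¬ P → [ P? ] ≈ 0#
  []-no (yes p) ¬p = contradiction p ¬p
  []-no (no _)  _  = refl

  []-cong : ∀ {p q} {P : Set p} {Q : Set q} (P? : Dec P) (Q? : Dec Q) →
    (P → Q) → (Q → P) → [ P? ] ≈ [ Q? ]
  []-cong P? Q? f g = reflexive (≡.cong (if_then 1# else 0#) (does-⇔ (mk⇔ f g) P? Q?))

  []-absorb : ∀ {p} {P : Set p} (P? : Dec P) {x} → (¬ P → x ≈ 0#) → [ P? ] * x ≈ x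
  []-absorb (yes _) {x} _ = *-identityˡ x
  []-absorb (no ¬p) {x} v = trans (zeroˡ x) (sym (v ¬p))

  vanish : ∀ y {x} → x ≈ 0# → y * x ≈ 0#
  vanish y x≈0 = trans (*-congˡ x≈0) (zeroʳ y)

  sum-δ : ∀ {n} (i : Fin n) (f : Fin n → Carrier) → sum (λ k → [ i ≟ k ] * f k) ≈ f i
  sum-δ {suc n} zero f = begin
    1# * f zero + sum (λ k → 0# * f (suc k))  ≈⟨ +-cong (*-identityˡ _) (sum-cong-≋ λ k → zeroˡ (f (suc k))) ⟩
    f zero + sum {n} (λ _ → 0#)               ≈⟨ +-congˡ (sum-replicate-zero n) ⟩
    f zero + 0#                               ≈⟨ +-identityʳ _ ⟩
    f zero                                    ∎
  -- `[ suc i ≟ suc k ]` reduces to `[ i ≟ k ]`, which makes the tail an instance of the induction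
  -- hypothesis.
  sum-δ {suc n} (suc i) f = begin
    0# * f zero + sum (λ k → [ i ≟ k ] * f (suc k))  ≈⟨ +-cong (zeroˡ _) (sum-δ i (f ∘ suc)) ⟩
    0# + f (suc i)                                   ≈⟨ +-identityˡ _ ⟩
    f (suc i)                                        ∎

  sum-+ : ∀ {n} {f g h : Fin n → Carrier} → (∀ i → f i ≈ g i + h i) → sum f ≈ sum g + sum h
  sum-+ {g = g} {h} f≈g+h = trans (sum-cong-≋ f≈g+h) (∑-distrib-+ g h)

  *-sum : ∀ {n} x {y} {f g : Fin n → Carrier} → y ≈ sum f → (∀ i → x * f i ≈ g i) → x * y ≈ sum g
  *-sum x {f = f} y≈∑f eq = trans (*-congˡ y≈∑f) (trans (*-distribˡ-sum x f) (sum-cong-≋ eq))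

  ×1-* : ∀ k x → (k ×ₙ 1#) * x ≈ k ×ₙ x
  ×1-* k x = trans (×-assoc-* k 1# x) (×-congʳ k (*-identityˡ x))

  -- Here `m` acts as -1 and `t` as 1/10. In the application `T` is the sum over all closed walks,
  -- `D` and `C` are the terms for one and two coincidences, and `K` is the cycle sum.
  solve-for-tenfold : ∀ {t m T C D K} → t * (10 ×ₙ 1#) ≈ 1# → m + 1# ≈ 0# →
    T + C ≈ 10 ×ₙ K + D → t * ((T + m * D) + C) ≈ K
  solve-for-tenfold {t} {m} {T} {C} {D} {K} t10≈1 m+1≈0 eq = begin
    t * ((T + m * D) + C)                        ≈⟨ *-congˡ (solve 3 (λ x y z → (x :+ y) :+ z := (x :+ z) :+ y) refl T (m * D) C) ⟩
    t * ((T + C) + m * D)                        ≈⟨ *-congˡ (+-congʳ eq) ⟩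
    t * ((10 ×ₙ K + D) + m * D)                  ≈⟨ *-congˡ (+-congʳ (+-congʳ (×1-* 10 K))) ⟨
    t * (((10 ×ₙ 1#) * K + D) + m * D)           ≈⟨ solve 5 (λ t m n k d → t :* ((n :* k :+ d) :+ m :* d) :=
                                                      (t :* n) :* k :+ t :* ((m :+ con 1) :* d))
                                                      refl t m (10 ×ₙ 1#) K D ⟩
    (t * (10 ×ₙ 1#)) * K + t * ((m + 1#) * D)    ≈⟨ +-cong (*-congʳ t10≈1) (vanish t (trans (*-congʳ m+1≈0) (zeroˡ D))) ⟩
    1# * K + 0#                                  ≈⟨ trans (+-identityʳ _) (*-identityˡ K) ⟩
    K                                            ∎

  -- Fivefold sums and the dihedral action on them

  module _ {n : ℕ} where

    infix 4 _≈⁵_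
    Quinary : Set c
    Quinary = (a b c d e : Fin n) → Carrier

    _≈⁵_ : Quinary → Quinary → Set ℓ
    F ≈⁵ G = ∀ a b c d e → F a b c d e ≈ G a b c d e

    ∑⁵ : Quinary → Carrier
    ∑⁵ F = sum λ a → sum λ b → sum λ c → sum λ d → sum λ e → F a b c d e

    ∑⁵-cong : ∀ {F G} → F ≈⁵ G → ∑⁵ F ≈ ∑⁵ G
    ∑⁵-cong F≈G = sum-cong-≋ λ a → sum-cong-≋ λ b → sum-cong-≋ λ c → sum-cong-≋ λ d →
      sum-cong-≋ λ e → F≈G a b c d e

    ∑⁵-+ : ∀ F G → ∑⁵ (λ a b c d e → F a b c d e + G a b c d e) ≈ ∑⁵ F + ∑⁵ G
    ∑⁵-+ F G = sum-+ λ a → sum-+ λ b → sum-+ λ c → sum-+ λ d → ∑-distrib-+ (F a b c d) (G a b c d)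

    sum-to-inner₂ : ∀ (F : (a b c : Fin n) → Carrier) →
      (sum λ a → sum λ b → sum λ c → F a b c) ≈ (sum λ b → sum λ c → sum λ a → F a b c)
    sum-to-inner₂ F = trans (∑-comm (λ a b → sum λ c → F a b c))
      (sum-cong-≋ λ b → ∑-comm (λ a c → F a b c))

    sum-to-inner₃ : ∀ (F : (a b c d : Fin n) → Carrier) →
      (sum λ a → sum λ b → sum λ c → sum λ d → F a b c d) ≈
      (sum λ b → sum λ c → sum λ d → sum λ a → F a b c d)
    sum-to-inner₃ F = trans (∑-comm (λ a b → sum λ c → sum λ d → F a b c d))
      (sum-cong-≋ λ b → sum-to-inner₂ (λ a c d → F a b c d))

    -- Generators of the dihedral action. The reflection fixes the first position, so a walk that
    -- starts at its least vertex still does so after reversal.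
    rotate reflect : Quinary → Quinary
    rotate  F a b c d e = F b c d e a
    reflect F a b c d e = F a e d c b

    ∑⁵-rotate : ∀ F → ∑⁵ (rotate F) ≈ ∑⁵ F
    ∑⁵-rotate F = trans (∑-comm (λ a b → sum λ c → sum λ d → sum λ e → F b c d e a))
      (sum-cong-≋ λ b → sum-to-inner₃ (λ a c d e → F b c d e a))

    ∑⁵-reflect : ∀ F → ∑⁵ (reflect F) ≈ ∑⁵ F
    ∑⁵-reflect F = sum-cong-≋ λ a → begin
      -- Four summation signs are reversed by carrying the outermost one inwards past three others,
      -- the next past two, the next past one.
      (sum λ b → sum λ c → sum λ d → sum λ e → F a e d c b)
        ≈⟨ sum-to-inner₃ (λ b c d e → F a e d c b) ⟩
      (sum λ c → sum λ d → sum λ e → sum λ b → F a e d c b)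
        ≈⟨ sum-to-inner₂ (λ c d e → sum λ b → F a e d c b) ⟩
      (sum λ d → sum λ e → sum λ c → sum λ b → F a e d c b)
        ≈⟨ ∑-comm (λ d e → sum λ c → sum λ b → F a e d c b) ⟩
      (sum λ e → sum λ d → sum λ c → sum λ b → F a e d c b) ∎

    -- Only the five rotations; the two directions are separated later, in `rooted≈normalised`.
    orbit : Quinary → Quinary
    orbit F a b c d e = F a b c d e + (F b c d e a + (F c d e a b + (F d e a b c + F e a b c d)))

    -- Since `Q` is invariant, a rotation of `F` times `Q` is the same rotation of the product, and
    -- `∑⁵` does not see rotations.
    ∑⁵-orbit : ∀ F Q → rotate Q ≈⁵ Q →
      ∑⁵ (λ a b c d e → orbit F a b c d e * Q a b c d e) ≈
      5 ×ₙ ∑⁵ (λ a b c d e → F a b c d e * Q a b c d e)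
    ∑⁵-orbit F Q inv = begin
      ∑⁵ (λ a b c d e → orbit F a b c d e * Q a b c d e)
        ≈⟨ ∑⁵-cong (λ a b c d e → trans
             (solve 6 (λ v x y z w q → (v :+ (x :+ (y :+ (z :+ w)))) :* q :=
                v :* q :+ (x :* q :+ (y :* q :+ (z :* q :+ w :* q)))) refl
                (F a b c d e) (F b c d e a) (F c d e a b) (F d e a b c) (F e a b c d) (Q a b c d e))
             (+-congˡ (+-cong (*-congˡ (inv₁ a b c d e)) (+-cong (*-congˡ (inv₂ a b c d e))
               (+-cong (*-congˡ (inv₃ a b c d e)) (*-congˡ (inv₄ a b c d e))))))) ⟩
      ∑⁵ (orbit FQ)
        ≈⟨ trans (∑⁵-+ FQ _) (+-congˡ (trans (∑⁵-+ (rot 1) _) (+-congˡ (trans (∑⁵-+ (rot 2) _)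
             (+-congˡ (∑⁵-+ (rot 3) (rot 4))))))) ⟩
      ∑⁵ FQ + (∑⁵ (rot 1) + (∑⁵ (rot 2) + (∑⁵ (rot 3) + ∑⁵ (rot 4))))
        -- `5 ×ₙ x` unfolds to a right-nested sum ending in `0#`; `+-identityʳ` supplies that zero.
        ≈⟨ +-congˡ (+-cong (∑⁵-rot 1) (+-cong (∑⁵-rot 2) (+-cong (∑⁵-rot 3)
             (trans (∑⁵-rot 4) (sym (+-identityʳ _)))))) ⟩
      5 ×ₙ ∑⁵ FQ ∎
      where
      FQ : Quinary
      FQ a b c d e = F a b c d e * Q a b c d e
      rot : ℕ → Quinary
      rot zero    = FQ
      rot (suc k) = rotate (rot k)
      ∑⁵-rot : ∀ k → ∑⁵ (rot k) ≈ ∑⁵ FQ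
      ∑⁵-rot zero    = refl
      ∑⁵-rot (suc k) = trans (∑⁵-rotate (rot k)) (∑⁵-rot k)
      inv₁ = λ a b c d e → sym (inv a b c d e)
      inv₂ = λ a b c d e → trans (inv₁ a b c d e) (inv₁ b c d e a)
      inv₃ = λ a b c d e → trans (inv₁ a b c d e) (inv₂ b c d e a)
      inv₄ = λ a b c d e → trans (inv₁ a b c d e) (inv₃ b c d e a)

    orbit-rotate : ∀ F → rotate (orbit F) ≈⁵ orbit F
    orbit-rotate F a b c d e = solve 5
      (λ v x y z w → x :+ (y :+ (z :+ (w :+ v))) := v :+ (x :+ (y :+ (z :+ w)))) refl
      (F a b c d e) (F b c d e a) (F c d e a b) (F d e a b c) (F e a b c d)

    [least] : Quinary
    [least] a b c d e = [ least? a b c d e ]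

    orbit-[least]-of-least : ∀ {a b c d e} → Least a b c d e → orbit [least] a b c d e ≈ 1#
    orbit-[least]-of-least {a} {b} {c} {d} {e} (ab , ac , ad , ae) = begin
      orbit [least] a b c d e
        ≈⟨ +-cong ([]-yes (least? a b c d e) (ab , ac , ad , ae))
          (+-cong ([]-no (least? b c d e a) λ (_ , _ , _ , ba) → Fin.<-asym ab ba)
          (+-cong ([]-no (least? c d e a b) λ (_ , _ , ca , _) → Fin.<-asym ac ca)
          (+-cong ([]-no (least? d e a b c) λ (_ , da , _ , _) → Fin.<-asym ad da)
                  ([]-no (least? e a b c d) λ (ea , _ , _ , _) → Fin.<-asym ae ea)))) ⟩
      1# + (0# + (0# + (0# + 0#)))
        ≈⟨ trans (+-congˡ (trans (+-congˡ (trans (+-congˡ (+-identityˡ 0#)) (+-identityˡ 0#))) (+-identityˡ 0#)))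
             (+-identityʳ 1#) ⟩
      1# ∎

    -- Exactly one rotation starts at the least vertex. As `orbit` is invariant, the walk may be
    -- turned until that vertex stands first.
    orbit-[least] : ∀ {a b c d e} → Consecutive a b c d e → Spread a b c d e →
      orbit [least] a b c d e ≈ 1#
    orbit-[least] {a} {b} {c} {d} {e} cons spr = by-position (some-least cons spr)
      where
      rotated : ∀ a b c d e → orbit [least] b c d e a ≈ 1# → orbit [least] a b c d e ≈ 1#
      rotated a b c d e = trans (sym (orbit-rotate [least] a b c d e))
      by-position : Least a b c d e ⊎ Least b c d e a ⊎ Least c d e a b ⊎ Least d e a b c ⊎ Least e a b c d →
        orbit [least] a b c d e ≈ 1#
      by-position (inj₁ l) = orbit-[least]-of-least l
      by-position (inj₂ (inj₁ l)) = rotated a b c d e (orbit-[least]-of-least l)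
      by-position (inj₂ (inj₂ (inj₁ l))) =
        rotated a b c d e (rotated b c d e a (orbit-[least]-of-least l))
      by-position (inj₂ (inj₂ (inj₂ (inj₁ l)))) =
        rotated a b c d e (rotated b c d e a (rotated c d e a b (orbit-[least]-of-least l)))
      -- One rotation in the opposite direction replaces four.
      by-position (inj₂ (inj₂ (inj₂ (inj₂ l)))) =
        trans (orbit-rotate [least] e a b c d) (orbit-[least]-of-least l)

  -- Inclusion-exclusion for five events on a circle

  void : ∀ {x y z t} → x ≈ 0# → x + y * x ≈ z * x + t * x
  void {x} {y} {z} {t} x≈0 = begin
    x + y * x      ≈⟨ +-cong x≈0 (vanish y x≈0) ⟩
    0# + 0#        ≈⟨ +-cong (vanish z x≈0) (vanish t x≈0) ⟨
    z * x + t * x  ∎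

  bit : ∀ {k} → Bool → Polynomial k
  bit b = con (if b then 1 else 0)

  -- The equation of `inclusion-exclusion` at fixed truth values, in the syntax of the solver.
  bits : (p q s t u : Bool) → Polynomial 1 → Polynomial 1 × Polynomial 1
  bits p q s t u x =
    x :+ (bit p :* bit q :+ (bit q :* bit s :+ (bit s :* bit t :+ (bit t :* bit u :+ bit u :* bit p)))) :* x :=
    bit (not p ∧ not q ∧ not s ∧ not t ∧ not u) :* x :+ (bit p :+ (bit q :+ (bit s :+ (bit t :+ bit u)))) :* x

  -- A semiring has no subtraction: the negative terms of inclusion–exclusion are moved to the other side.
  inclusion-exclusion : ∀ {p} {P Q S T U : Set p}
    (P? : Dec P) (Q? : Dec Q) (S? : Dec S) (T? : Dec T) (U? : Dec U) {x} →
    (P → S → x ≈ 0#) → (Q → T → x ≈ 0#) → (S → U → x ≈ 0#) → (T → P → x ≈ 0#) → (U → Q → x ≈ 0#) →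
    x + ([ P? ] * [ Q? ] + ([ Q? ] * [ S? ] + ([ S? ] * [ T? ] + ([ T? ] * [ U? ] + [ U? ] * [ P? ])))) * x ≈
    [ ¬? P? ×-dec ¬? Q? ×-dec ¬? S? ×-dec ¬? T? ×-dec ¬? U? ] * x +
      ([ P? ] + ([ Q? ] + ([ S? ] + ([ T? ] + [ U? ])))) * x
  -- The first five clauses are the pairs of non-neighbouring events, where `x` vanishes. Eleven
  -- patterns remain: no event, one event, or two neighbouring ones.
  inclusion-exclusion (yes p) _ (yes s) _ _ ps qt su tp uq = void (ps p s)
  inclusion-exclusion _ (yes q) _ (yes t) _ ps qt su tp uq = void (qt q t)
  inclusion-exclusion _ _ (yes s) _ (yes u) ps qt su tp uq = void (su s u)
  inclusion-exclusion (yes p) _ _ (yes t) _ ps qt su tp uq = void (tp t p)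
  inclusion-exclusion _ (yes q) _ _ (yes u) ps qt su tp uq = void (uq u q)
  inclusion-exclusion (no _) (no _) (no _) (no _) (no _) {x} _ _ _ _ _ =
    solve 1 (bits false false false false false) refl x
  inclusion-exclusion (yes _) (no _) (no _) (no _) (no _) {x} _ _ _ _ _ =
    solve 1 (bits true false false false false) refl x
  inclusion-exclusion (no _) (yes _) (no _) (no _) (no _) {x} _ _ _ _ _ =
    solve 1 (bits false true false false false) refl x
  inclusion-exclusion (no _) (no _) (yes _) (no _) (no _) {x} _ _ _ _ _ =
    solve 1 (bits false false true false false) refl x
  inclusion-exclusion (no _) (no _) (no _) (yes _) (no _) {x} _ _ _ _ _ =
    solve 1 (bits false false false true false) refl x
  inclusion-exclusion (no _) (no _) (no _) (no _) (yes _) {x} _ _ _ _ _ =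
    solve 1 (bits false false false false true) refl x
  inclusion-exclusion (yes _) (yes _) (no _) (no _) (no _) {x} _ _ _ _ _ =
    solve 1 (bits true true false false false) refl x
  inclusion-exclusion (no _) (yes _) (yes _) (no _) (no _) {x} _ _ _ _ _ =
    solve 1 (bits false true true false false) refl x
  inclusion-exclusion (no _) (no _) (yes _) (yes _) (no _) {x} _ _ _ _ _ =
    solve 1 (bits false false true true false) refl x
  inclusion-exclusion (no _) (no _) (no _) (yes _) (yes _) {x} _ _ _ _ _ =
    solve 1 (bits false false false true true) refl x
  inclusion-exclusion (yes _) (no _) (no _) (no _) (yes _) {x} _ _ _ _ _ =
    solve 1 (bits true false false false true) refl x

  -- Closed walks weighted by a symmetric matrix with zero diagonal

  module _ {n : ℕ} (M : Fin n → Fin n → Carrier)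
           (symmetric : ∀ i j → M i j ≈ M j i) (loopless : ∀ i → M i i ≈ 0#) where

    -- The final `1#` and the nesting to the right are those of `productₚ`, so that `cycleWeight` of
    -- five vertices is this expression by computation.
    walk : Quinary {n}
    walk a b c d e = M a b * (M b c * (M c d * (M d e * (M e a * 1#))))

    walk-rotate : rotate walk ≈⁵ walk
    walk-rotate a b c d e = solve 5
      (λ v x y z w → x :* (y :* (z :* (w :* (v :* con 1)))) := v :* (x :* (y :* (z :* (w :* con 1)))))
      refl (M a b) (M b c) (M c d) (M d e) (M e a)

    walk-reflect : reflect walk ≈⁵ walk
    walk-reflect a b c d e = begin
      M a e * (M e d * (M d c * (M c b * (M b a * 1#))))
        ≈⟨ *-cong (symmetric a e) (*-cong (symmetric e d) (*-cong (symmetric d c)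
             (*-cong (symmetric c b) (*-congʳ (symmetric b a))))) ⟩
      M e a * (M d e * (M c d * (M b c * (M a b * 1#))))
        ≈⟨ solve 5 (λ v x y z w → w :* (z :* (y :* (x :* (v :* con 1)))) :=
             v :* (x :* (y :* (z :* (w :* con 1)))))
             refl (M a b) (M b c) (M c d) (M d e) (M e a) ⟩
      walk a b c d e ∎

    walk-loop : ∀ {a b c d e} → a ≡ b → walk a b c d e ≈ 0#
    walk-loop {a} ≡.refl = trans (*-congʳ (loopless a)) (zeroˡ _)

    -- A rotation brings the degenerate side to the front, where it contributes a diagonal entry of
    -- `M`.
    walk-not-consecutive : ∀ {a b c d e} → ¬ Consecutive a b c d e → walk a b c d e ≈ 0#
    walk-not-consecutive {a} {b} {c} {d} {e} ¬cons
      with a ≟ b | b ≟ c | c ≟ d | d ≟ e | e ≟ a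
    ... | yes p | _ | _ | _ | _ = walk-loop p
    ... | no _ | yes p | _ | _ | _ = trans (sym (walk-rotate a b c d e)) (walk-loop p)
    ... | no _ | no _ | yes p | _ | _ = trans (sym (trans (walk-rotate b c d e a)
            (walk-rotate a b c d e))) (walk-loop p)
    ... | no _ | no _ | no _ | yes p | _ = trans (sym (trans (walk-rotate c d e a b)
            (trans (walk-rotate b c d e a) (walk-rotate a b c d e)))) (walk-loop p)
    ... | no _ | no _ | no _ | no _ | yes p = trans (walk-rotate e a b c d) (walk-loop p)
    ... | no ab | no bc | no cd | no de | no ea = contradiction (ab , bc , cd , de , ea) ¬cons

    -- Supported on five distinct vertices: the bracket separates the ends of diagonals, the zero
    -- diagonal of `M` the ends of sides.
    pentagon : Quinary {n}
    pentagon a b c d e = [ spread? a b c d e ] * walk a b c d e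

    pentagon-rotate : rotate pentagon ≈⁵ pentagon
    pentagon-rotate a b c d e = *-cong
      ([]-cong (spread? b c d e a) (spread? a b c d e)
        -- The inverse of the rotation is its fourth power.
        (rotate-spread ∘ rotate-spread ∘ rotate-spread ∘ rotate-spread) rotate-spread)
      (walk-rotate a b c d e)

    pentagon-reflect : reflect pentagon ≈⁵ pentagon
    pentagon-reflect a b c d e = *-cong
      ([]-cong (spread? a e d c b) (spread? a b c d e) reflect-spread reflect-spread)
      (walk-reflect a b c d e)

    pentagon-not-spread : ∀ {a b c d e} → ¬ Spread a b c d e → pentagon a b c d e ≈ 0#
    pentagon-not-spread {a} {b} {c} {d} {e} ¬spr =
      trans (*-congʳ ([]-no (spread? a b c d e) ¬spr)) (zeroˡ _)

    pentagon-not-consecutive : ∀ {a b c d e} → ¬ Consecutive a b c d e → pentagon a b c d e ≈ 0#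
    pentagon-not-consecutive ¬cons = vanish _ (walk-not-consecutive ¬cons)

    rooted normalised : Quinary {n}
    rooted     a b c d e = [least] a b c d e * pentagon a b c d e
    normalised a b c d e = [least] a b c d e * ([ b <? e ] * pentagon a b c d e)

    -- The inserted factor is 1 on distinct vertices, and on all other walks `pentagon` is zero.
    pentagon≈orbit-rooted : pentagon ≈⁵ λ a b c d e → orbit [least] a b c d e * pentagon a b c d e
    pentagon≈orbit-rooted a b c d e = by-cases (consecutive? a b c d e) (spread? a b c d e)
      where
      by-cases : Dec (Consecutive a b c d e) → Dec (Spread a b c d e) →
        pentagon a b c d e ≈ orbit [least] a b c d e * pentagon a b c d e
      by-cases (yes cons) (yes spr) = sym (trans (*-congʳ (orbit-[least] cons spr)) (*-identityˡ _))
      by-cases (no ¬cons) _         = let p≈0 = pentagon-not-consecutive ¬cons in trans p≈0 (sym (vanish _ p≈0))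
      by-cases (yes _)    (no ¬spr) = let p≈0 = pentagon-not-spread ¬spr in trans p≈0 (sym (vanish _ p≈0))

    -- Of a walk and its reversal exactly one has its second vertex below its last; equality of the
    -- two is a coincidence that `Spread` excludes.
    rooted≈normalised : rooted ≈⁵ λ a b c d e → normalised a b c d e + reflect normalised a b c d e
    rooted≈normalised a b c d e with Fin.<-cmp b e
    ... | tri< b<e _ e≮b = sym (begin
      normalised a b c d e + reflect normalised a b c d e
        ≈⟨ +-cong (*-congˡ (trans (*-congʳ ([]-yes (b <? e) b<e)) (*-identityˡ _)))
             (vanish _ (trans (*-congʳ ([]-no (e <? b) e≮b)) (zeroˡ _))) ⟩
      rooted a b c d e + 0#  ≈⟨ +-identityʳ _ ⟩
      rooted a b c d e       ∎)
    ... | tri> b≮e _ e<b = sym (begin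
      normalised a b c d e + reflect normalised a b c d e
        ≈⟨ +-cong (vanish _ (trans (*-congʳ ([]-no (b <? e) b≮e)) (zeroˡ _)))
             (*-cong ([]-cong (least? a e d c b) (least? a b c d e) reflect-least reflect-least)
               (trans (*-congʳ ([]-yes (e <? b) e<b)) (trans (*-identityˡ _) (pentagon-reflect a b c d e)))) ⟩
      0# + rooted a b c d e  ≈⟨ +-identityˡ _ ⟩
      rooted a b c d e       ∎)
    ... | tri≈ _ b≡e _ = begin
      rooted a b c d e  ≈⟨ vanish _ p≈0 ⟩
      0#                ≈⟨ +-identityˡ 0# ⟨
      0# + 0#           ≈⟨ +-cong (vanish _ (vanish _ p≈0))
                             (vanish _ (vanish _ (trans (pentagon-reflect a b c d e) p≈0))) ⟨
      normalised a b c d e + reflect normalised a b c d e ∎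
      where
      p≈0 : pentagon a b c d e ≈ 0#
      p≈0 = pentagon-not-spread λ (_ , _ , _ , _ , e≢b) → e≢b (≡.sym b≡e)

    ∑⁵-pentagon : ∑⁵ pentagon ≈ 10 ×ₙ ∑⁵ normalised
    ∑⁵-pentagon = begin
      ∑⁵ pentagon     ≈⟨ ∑⁵-cong pentagon≈orbit-rooted ⟩
      ∑⁵ (λ a b c d e → orbit [least] a b c d e * pentagon a b c d e)
                      ≈⟨ ∑⁵-orbit [least] pentagon pentagon-rotate ⟩
      5 ×ₙ ∑⁵ rooted  ≈⟨ ×-congʳ 5 (trans (∑⁵-cong rooted≈normalised)
                           (trans (∑⁵-+ normalised (reflect normalised)) (+-congˡ (∑⁵-reflect normalised)))) ⟩
      5 ×ₙ (∑⁵ normalised + ∑⁵ normalised)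
        ≈⟨ solve 1 (λ x → let y = x :+ x in y :+ (y :+ (y :+ (y :+ (y :+ con 0)))) :=
             x :+ (x :+ (x :+ (x :+ (x :+ (x :+ (x :+ (x :+ (x :+ (x :+ con 0)))))))))) refl (∑⁵ normalised) ⟩
      10 ×ₙ ∑⁵ normalised ∎

    -- One event and one neighbouring pair. Their orbits unfold to precisely the two bracket sums of
    -- `inclusion-exclusion`.
    [meets] [meets₂] : Quinary {n}
    [meets]  a b c d e = [ a ≟ c ]
    [meets₂] a b c d e = [ a ≟ c ] * [ b ≟ d ]

    walk-inclusion-exclusion : ∀ a b c d e →
      walk a b c d e + orbit [meets₂] a b c d e * walk a b c d e ≈
      pentagon a b c d e + orbit [meets] a b c d e * walk a b c d e
    walk-inclusion-exclusion a b c d e =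
      inclusion-exclusion (a ≟ c) (b ≟ d) (c ≟ e) (d ≟ a) (e ≟ b)
        -- Two non-neighbouring events share a vertex, and chaining them identifies the ends of a
        -- side.
        (λ a≡c c≡e → zero-if λ (_ , _ , _ , _ , e≢a) → e≢a (≡.sym (≡.trans a≡c c≡e)))
        (λ b≡d d≡a → zero-if λ (a≢b , _) → a≢b (≡.sym (≡.trans b≡d d≡a)))
        (λ c≡e e≡b → zero-if λ (_ , b≢c , _) → b≢c (≡.sym (≡.trans c≡e e≡b)))
        (λ d≡a a≡c → zero-if λ (_ , _ , c≢d , _) → c≢d (≡.sym (≡.trans d≡a a≡c)))
        (λ e≡b b≡d → zero-if λ (_ , _ , _ , d≢e , _) → d≢e (≡.sym (≡.trans e≡b b≡d)))
      where
      zero-if : ¬ Consecutive a b c d e → walk a b c d e ≈ 0#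
      zero-if = walk-not-consecutive

    ∑⁵-meets : ∑⁵ (λ a b c d e → [meets] a b c d e * walk a b c d e) ≈
      sum λ a → sum λ b → sum λ d → sum λ e → walk a b a d e
    ∑⁵-meets = sum-cong-≋ λ a → sum-cong-≋ λ b → begin
      (sum λ c → sum λ d → sum λ e → [ a ≟ c ] * walk a b c d e)
        ≈⟨ (sum-cong-≋ λ c → trans (*-distribˡ-sum [ a ≟ c ] (λ d → sum λ e → walk a b c d e))
             (sum-cong-≋ λ d → *-distribˡ-sum [ a ≟ c ] (λ e → walk a b c d e))) ⟨
      (sum λ c → [ a ≟ c ] * sum λ d → sum λ e → walk a b c d e)
        ≈⟨ sum-δ a (λ c → sum λ d → sum λ e → walk a b c d e) ⟩
      (sum λ d → sum λ e → walk a b a d e) ∎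

    ∑⁵-meets₂ : ∑⁵ (λ a b c d e → [meets₂] a b c d e * walk a b c d e) ≈
      sum λ a → sum λ b → sum λ e → walk a b a b e
    ∑⁵-meets₂ = sum-cong-≋ λ a → sum-cong-≋ λ b → begin
      (sum λ c → sum λ d → sum λ e → [ a ≟ c ] * [ b ≟ d ] * walk a b c d e)
        ≈⟨ (sum-cong-≋ λ c → trans (*-distribˡ-sum [ a ≟ c ] (λ d → [ b ≟ d ] * sum λ e → walk a b c d e)) (sum-cong-≋ λ d →
             trans (*-congˡ (*-distribˡ-sum [ b ≟ d ] (λ e → walk a b c d e)))
             (trans (*-distribˡ-sum [ a ≟ c ] (λ e → [ b ≟ d ] * walk a b c d e))
             (sum-cong-≋ λ e → sym (*-assoc [ a ≟ c ] [ b ≟ d ] (walk a b c d e)))))) ⟨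
      (sum λ c → [ a ≟ c ] * sum λ d → [ b ≟ d ] * sum λ e → walk a b c d e)
        ≈⟨ sum-δ a (λ c → sum λ d → [ b ≟ d ] * sum λ e → walk a b c d e) ⟩
      (sum λ d → [ b ≟ d ] * sum λ e → walk a b a d e)
        ≈⟨ sum-δ b (λ d → sum λ e → walk a b a d e) ⟩
      (sum λ e → walk a b a b e) ∎

    closed-walks :
      ∑⁵ walk + 5 ×ₙ (sum λ a → sum λ b → sum λ e → walk a b a b e) ≈
      10 ×ₙ ∑⁵ normalised + 5 ×ₙ (sum λ a → sum λ b → sum λ d → sum λ e → walk a b a d e)
    closed-walks = begin
      ∑⁵ walk + 5 ×ₙ (sum λ a → sum λ b → sum λ e → walk a b a b e)
        ≈⟨ +-congˡ (trans (∑⁵-orbit [meets₂] walk walk-rotate) (×-congʳ 5 ∑⁵-meets₂)) ⟨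
      ∑⁵ walk + ∑⁵ (λ a b c d e → orbit [meets₂] a b c d e * walk a b c d e)
        ≈⟨ ∑⁵-+ walk (λ a b c d e → orbit [meets₂] a b c d e * walk a b c d e) ⟨
      ∑⁵ (λ a b c d e → walk a b c d e + orbit [meets₂] a b c d e * walk a b c d e)
        ≈⟨ ∑⁵-cong walk-inclusion-exclusion ⟩
      ∑⁵ (λ a b c d e → pentagon a b c d e + orbit [meets] a b c d e * walk a b c d e)
        ≈⟨ ∑⁵-+ pentagon (λ a b c d e → orbit [meets] a b c d e * walk a b c d e) ⟩
      ∑⁵ pentagon + ∑⁵ (λ a b c d e → orbit [meets] a b c d e * walk a b c d e)
        ≈⟨ +-cong ∑⁵-pentagon (trans (∑⁵-orbit [meets] walk walk-rotate) (×-congʳ 5 ∑⁵-meets)) ⟩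
      10 ×ₙ ∑⁵ normalised + 5 ×ₙ (sum λ a → sum λ b → sum λ d → sum λ e → walk a b a d e) ∎

    -- Traces as sums over closed walks

    module _ (𝟙 : Fin n → Fin n → Carrier) (𝟙≈ : ∀ i j → 𝟙 i j ≈ [ j ≟ i ]) where

      power : ℕ → Fin n → Fin n → Carrier
      power zero          = 𝟙
      power (suc k) i j = sum λ l → M i l * power k l j

      -- The factor `1#` is kept on purpose: unfolded powers then end exactly like `walk`, and the
      -- comparisons close by `refl`.
      power₁ : ∀ i j → power 1 i j ≈ M i j * 1#
      power₁ i j = begin
        (sum λ k → M i k * 𝟙 k j)        ≈⟨ (sum-cong-≋ λ k → trans (*-comm (M i k) (𝟙 k j)) (*-congʳ (𝟙≈ k j))) ⟩
        (sum λ k → [ j ≟ k ] * M i k)    ≈⟨ sum-δ j (M i) ⟩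
        M i j                            ≈⟨ *-identityʳ (M i j) ⟨
        M i j * 1#                       ∎

      power₂ : ∀ i j → power 2 i j ≈ sum λ k → M i k * (M k j * 1#)
      power₂ i j = sum-cong-≋ λ k → *-congˡ (power₁ k j)

      power₃ : ∀ i j → power 3 i j ≈ sum λ k → sum λ l → M i k * (M k l * (M l j * 1#))
      power₃ i j = sum-cong-≋ λ k → *-sum {n} (M i k) (power₂ k j) λ l → refl

      power₄ : ∀ i j → power 4 i j ≈ sum λ k → sum λ l → sum λ m → M i k * (M k l * (M l m * (M m j * 1#)))
      power₄ i j = sum-cong-≋ λ k → *-sum {n} (M i k) (power₃ k j) λ l → *-sum {n} (M i k) refl λ m → refl

      trace-power₅ : (sum λ i → power 5 i i) ≈ ∑⁵ walk
      trace-power₅ = sum-cong-≋ λ a → sum-cong-≋ λ b → *-sum {n} (M a b) (power₄ b a) λ c →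
        *-sum {n} (M a b) refl λ d → *-sum {n} (M a b) refl λ e → refl

      square cube : Fin n → Fin n → Carrier
      square i j = M i j * (M i j * 1#)
      cube   i j = M i j * square i j

      squares-power₃ : (sum λ i → sum (square i) * power 3 i i) ≈
        sum λ a → sum λ b → sum λ d → sum λ e → walk a b a d e
      squares-power₃ = sum-cong-≋ λ a → trans (*-distribʳ-sum (power 3 a a) (square a))
        (sum-cong-≋ λ b → *-sum {n} (square a b) (power₃ a a) λ d → *-sum {n} (square a b) refl λ e →
          -- Symmetry turns the second factor of the square into the step back from `b` to `a`.
          trans (*-assoc (M a b) (M a b * 1#) _)
            (*-congˡ (*-congʳ (trans (*-identityʳ (M a b)) (symmetric a b)))))

      cubes-power₂ : (sum λ i → sum λ j → cube i j * power 2 j i) ≈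
        sum λ a → sum λ b → sum λ e → walk a b a b e
      cubes-power₂ = sum-cong-≋ λ a → sum-cong-≋ λ b → *-sum {n} (cube a b) (power₂ b a) λ e →
        trans (*-assoc (M a b) (square a b) _) (*-congˡ
          (trans (*-assoc (M a b) (M a b * 1#) _)
            (*-cong (symmetric a b) (*-congʳ (*-identityʳ (M a b))))))

      -- Bridges the two forms of the last term: the trace of a product reads the second factor at
      -- `(j , i)`, the formula in entries at `(i , j)`.
      power₂-symmetric : ∀ i j → power 2 i j ≈ power 2 j i
      power₂-symmetric i j = trans (power₂ i j) (trans (sum-cong-≋ reverse) (sym (power₂ j i)))
        where
        reverse : ∀ k → M i k * (M k j * 1#) ≈ M j k * (M k i * 1#)
        reverse k = trans (*-cong (symmetric i k) (*-congʳ (symmetric k j)))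
          (solve 2 (λ x y → x :* (y :* con 1) := y :* (x :* con 1)) refl (M k i) (M j k))

      module _ (Δ : Fin n → Fin n → Carrier) (Δ≈ : ∀ i j → Δ i j ≈ [ i ≟ j ] * sum (square i)) where

        trace-Δ-power₃ : (sum λ i → sum λ k → Δ i k * power 3 k i) ≈ (sum λ i → sum (square i) * power 3 i i)
        trace-Δ-power₃ = sum-cong-≋ λ i → trans
          (sum-cong-≋ λ k → trans (*-congʳ (Δ≈ i k)) (*-assoc [ i ≟ k ] (sum (square i)) (power 3 k i)))
          (sum-δ i (λ k → sum (square i) * power 3 k i))

        -- The left side has the shape to which `Φ₅` unfolds, where `p - q` is `p` plus a constant
        -- times `q`; `f`, `m` and `t` stand for 5, -1 and 1/10.
        trace-formula : ∀ f m t → f ≈ 5 ×ₙ 1# → m + 1# ≈ 0# → t * (10 ×ₙ 1#) ≈ 1# →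
          t * (((sum λ i → power 5 i i) + m * (f * (sum λ i → sum λ k → Δ i k * power 3 k i)))
            + f * (sum λ i → sum λ j → cube i j * power 2 j i)) ≈ ∑⁵ normalised
        trace-formula f m t f≈5 m+1≈0 t10≈1 = trans
          (*-congˡ (+-cong (+-cong trace-power₅
              (*-congˡ (trans (*-congʳ f≈5) (trans (×1-* 5 _) (×-congʳ 5 (trans trace-Δ-power₃ squares-power₃))))))
            (trans (*-congʳ f≈5) (trans (×1-* 5 _) (×-congʳ 5 cubes-power₂)))))
          (solve-for-tenfold t10≈1 m+1≈0 closed-walks)

        trace-formula-entries : ∀ f m t →
          t * (((sum λ i → power 5 i i) + m * (f * (sum λ i → sum λ k → Δ i k * power 3 k i)))
            + f * (sum λ i → sum λ j → cube i j * power 2 j i)) ≈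
          t * (((sum λ i → power 5 i i) + m * (f * (sum λ i → sum (square i) * power 3 i i)))
            + f * (sum λ i → sum λ j → cube i j * power 2 i j))
        trace-formula-entries f m t = *-congˡ (+-cong (+-congˡ (*-congˡ (*-congˡ trace-Δ-power₃)))
          (*-congˡ (sum-cong-≋ λ i → sum-cong-≋ λ j → *-congˡ (power₂-symmetric j i))))

-- The polynomial semiring

open import Defs

module PolySemiring where
  open ≡ using (refl; sym; trans; cong; cong₂)

  -- As a record, unlike _≈_, this determines its two polynomials in unification.
  infix 4 _≋_
  record _≋_ (p q : Poly) : Set where
    constructor coeffs
    field coeff≡ : p ≈ q
  open _≋_ public

  ≋-isEquivalence : IsEquivalence _≋_
  ≋-isEquivalence = record
    { refl  = coeffs λ _ _ → refl
    ; sym   = λ (coeffs e) → coeffs λ a b → sym (e a b)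
    ; trans = λ (coeffs e) (coeffs f) → coeffs λ a b → trans (e a b) (f a b)
    }

  module ≋ = IsEquivalence ≋-isEquivalence
  ≋-setoid : Setoid 0ℓ 0ℓ
  ≋-setoid = record { isEquivalence = ≋-isEquivalence }

  ≡⇒≋ : ∀ {p q} → p ≡ q → p ≋ q
  ≡⇒≋ refl = ≋.refl

  coeff-+ : ∀ p q a b → coeff (p + q) a b ≡ coeff p a b ℚ.+ coeff q a b
  coeff-+ []      q a b = sym (ℚ.+-identityˡ _)
  coeff-+ ((c , i , j) ∷ p) q a b =
    trans (cong (x ℚ.+_) (coeff-+ p q a b)) (sym (ℚ.+-assoc x (coeff p a b) (coeff q a b)))
    where
    x : ℚ
    x = if (i ℕ.≡ᵇ a) ∧ (j ℕ.≡ᵇ b) then c else 0ℚ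

  +-cong : ∀ {p p′ q q′} → p ≋ p′ → q ≋ q′ → p + q ≋ p′ + q′
  +-cong {p} {p′} {q} {q′} (coeffs e) (coeffs f) = coeffs λ a b →
    trans (coeff-+ p q a b) (trans (cong₂ ℚ._+_ (e a b) (f a b)) (sym (coeff-+ p′ q′ a b)))

  +-comm : ∀ p q → p + q ≋ q + p
  +-comm p q = coeffs λ a b →
    trans (coeff-+ p q a b) (trans (ℚ.+-comm (coeff p a b) _) (sym (coeff-+ q p a b)))

  scale : ∀ c q a b → coeff (List.map (mulTerm (c , 0 , 0)) q) a b ≡ c ℚ.* coeff q a b
  scale c []                a b = sym (ℚ.*-zeroʳ c)
  scale c ((d , i , j) ∷ q) a b with (i ℕ.≡ᵇ a) ∧ (j ℕ.≡ᵇ b)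
  ... | true  = trans (cong (c ℚ.* d ℚ.+_) (scale c q a b)) (sym (ℚ.*-distribˡ-+ c d _))
  ... | false = trans (cong₂ ℚ._+_ (sym (ℚ.*-zeroʳ c)) (scale c q a b)) (sym (ℚ.*-distribˡ-+ c 0ℚ _))

  -- Equal coefficients say nothing about the shape of the lists, so the coefficients of the product
  -- are computed: each factor `w` or `r` of the monomial shifts them by one, and the remaining
  -- constant scales them.
  map-mulTerm-cong : ∀ c i j {q q′} → q ≈ q′ →
    List.map (mulTerm (c , i , j)) q ≈ List.map (mulTerm (c , i , j)) q′
  map-mulTerm-cong c zero zero {q} {q′} e a b =
    trans (scale c q a b) (trans (cong (c ℚ.*_) (e a b)) (sym (scale c q′ a b)))
  map-mulTerm-cong c zero (suc j) {q} {q′} e a b = trans (down q b) (trans (step b) (sym (down q′ b)))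
    where
    lowered : Poly → ℕ → ℚ
    -- A multiple of `r` has no part of degree 0 in `r`.
    lowered p zero    = 0ℚ
    lowered p (suc b) = coeff (List.map (mulTerm (c , zero , j)) p) a b
    down : ∀ p b → coeff (List.map (mulTerm (c , zero , suc j)) p) a b ≡ lowered p b
    down []                zero    = refl
    down []                (suc b) = refl
    -- The second conjunct is `false`, but `_∧_` reduces only once its first argument is known.
    down ((_ , i , _) ∷ p) zero    with i ℕ.≡ᵇ a
    ... | true  = trans (ℚ.+-identityˡ _) (down p zero)
    ... | false = trans (ℚ.+-identityˡ _) (down p zero)
    down ((d , k , l) ∷ p) (suc b) =
      cong ((if (k ℕ.≡ᵇ a) ∧ (j ℕ.+ l ℕ.≡ᵇ b) then c ℚ.* d else 0ℚ) ℚ.+_) (down p (suc b))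
    step : ∀ b → lowered q b ≡ lowered q′ b
    step zero    = refl
    step (suc b) = map-mulTerm-cong c zero j {q} {q′} e a b
  map-mulTerm-cong c (suc i) j {q} {q′} e a b = trans (down q a) (trans (step a) (sym (down q′ a)))
    where
    lowered : Poly → ℕ → ℚ
    lowered p zero    = 0ℚ
    lowered p (suc a) = coeff (List.map (mulTerm (c , i , j)) p) a b
    down : ∀ p a → coeff (List.map (mulTerm (c , suc i , j)) p) a b ≡ lowered p a
    down []      zero    = refl
    down []      (suc a) = refl
    down (_ ∷ p) zero    = trans (ℚ.+-identityˡ _) (down p zero)
    down ((d , k , l) ∷ p) (suc a) =
      cong ((if (i ℕ.+ k ℕ.≡ᵇ a) ∧ (j ℕ.+ l ℕ.≡ᵇ b) then c ℚ.* d else 0ℚ) ℚ.+_) (down p (suc a))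
    step : ∀ a → lowered q a ≡ lowered q′ a
    step zero    = refl
    step (suc a) = map-mulTerm-cong c i j {q} {q′} e a b

  *-congˡ : ∀ p {q q′} → q ≋ q′ → p * q ≋ p * q′
  *-congˡ []                e = ≋.refl
  *-congˡ ((c , i , j) ∷ p) {q} {q′} e =
    +-cong (coeffs (map-mulTerm-cong c i j {q} {q′} (coeff≡ e))) (*-congˡ p e)

  mulTerm-comm : ∀ s t → mulTerm s t ≡ mulTerm t s
  mulTerm-comm (c , i , j) (d , k , l) =
    cong₂ _,_ (ℚ.*-comm c d) (cong₂ _,_ (ℕ.+-comm i k) (ℕ.+-comm j l))

  mulTerm-assoc : ∀ s t u → mulTerm (mulTerm s t) u ≡ mulTerm s (mulTerm t u)
  mulTerm-assoc (c , i , j) (d , k , l) (e , m , n) =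
    cong₂ _,_ (ℚ.*-assoc c d e) (cong₂ _,_ (ℕ.+-assoc i k m) (ℕ.+-assoc j l n))

  mulTerm-identityˡ : ∀ t → mulTerm (1ℚ , 0 , 0) t ≡ t
  mulTerm-identityˡ (c , i , j) = cong (_, i , j) (ℚ.*-identityˡ c)

  -- The product recurses on its left factor; commutativity also needs this recursion on the right
  -- one, which permutes terms and hence holds only up to `_≋_`.
  *-∷ : ∀ p t q → p * (t ∷ q) ≋ List.map (mulTerm t) p + p * q
  *-∷ []      t q = ≋.refl
  *-∷ (s ∷ p) t q = begin
    (mulTerm s t ∷ []) + (sq + p * (t ∷ q))  ≈⟨ +-cong (≡⇒≋ (cong (_∷ []) (mulTerm-comm s t))) (+-cong (≋.refl {sq}) (*-∷ p t q)) ⟩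
    (mulTerm t s ∷ []) + (sq + (tp + p * q)) ≡⟨ cong (mulTerm t s ∷_) (++-assoc sq tp _) ⟨
    (mulTerm t s ∷ []) + ((sq + tp) + p * q) ≈⟨ +-cong (≋.refl {mulTerm t s ∷ []}) (+-cong (+-comm sq tp) ≋.refl) ⟩
    (mulTerm t s ∷ []) + ((tp + sq) + p * q) ≡⟨ cong (mulTerm t s ∷_) (++-assoc tp sq _) ⟩
    (mulTerm t s ∷ []) + (tp + (sq + p * q)) ∎
    where
    open SetoidReasoning ≋-setoid
    sq = List.map (mulTerm s) q
    tp = List.map (mulTerm t) p

  *-comm : ∀ p q → p * q ≋ q * p
  *-comm []      q = ≡⇒≋ (sym (cartesianProductWith-zeroʳ mulTerm q))
  *-comm (t ∷ p) q = ≋.trans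
    (+-cong (≋.refl {List.map (mulTerm t) q}) (*-comm p q)) (≋.sym (*-∷ q t p))

  map-mulTerm-* : ∀ t q s → List.map (mulTerm t) q * s ≡ List.map (mulTerm t) (q * s)
  map-mulTerm-* t []      s = refl
  map-mulTerm-* t (u ∷ q) s = trans
    (cong₂ _+_ (trans (map-cong (mulTerm-assoc t u) s) (map-∘ s)) (map-mulTerm-* t q s))
    (sym (map-++ (mulTerm t) (List.map (mulTerm u) s) (q * s)))

  *-distribʳ-+ : ∀ s p q → (p + q) * s ≡ p * s + q * s
  *-distribʳ-+ s p q = cartesianProductWith-distribʳ-++ mulTerm p q s

  *-assoc : ∀ p q s → (p * q) * s ≡ p * (q * s)
  *-assoc []      q s = refl
  *-assoc (t ∷ p) q s = trans
    (*-distribʳ-+ s (List.map (mulTerm t) q) (p * q))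
    (cong₂ _+_ (map-mulTerm-* t q s) (*-assoc p q s))

  *-identityˡ : ∀ p → 1ₚ * p ≡ p
  *-identityˡ []      = refl
  *-identityˡ (t ∷ p) = cong₂ _∷_ (mulTerm-identityˡ t) (*-identityˡ p)

  polySemiring : CommutativeSemiring 0ℓ 0ℓ
  polySemiring = record
    { Carrier = Poly
    ; _≈_     = _≋_
    ; _+_     = _+_
    ; _*_     = _*_
    ; 0#      = 0ₚ
    ; 1#      = 1ₚ
    ; isCommutativeSemiring = isCommutativeSemiringˡ record
      { +-isCommutativeMonoid = record
        { isMonoid = record
          { isSemigroup = record
            { isMagma = record { isEquivalence = ≋-isEquivalence ; ∙-cong = +-cong }
            ; assoc   = λ p q s → ≡⇒≋ (++-assoc p q s)
            }
          ; identity = (λ _ → ≋.refl) , λ p → +-comm p 0ₚ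
          }
        ; comm = +-comm
        }
      ; *-isCommutativeMonoid = record
        { isMonoid = record
          { isSemigroup = record
            { isMagma = record
              { isEquivalence = ≋-isEquivalence
              -- Congruence in the left factor is congruence in the right one conjugated by
              -- `*-comm`.
              ; ∙-cong = λ {p} {p′} {q} {q′} e f → ≋.trans (*-congˡ p f)
                  (≋.trans (*-comm p q′) (≋.trans (*-congˡ q′ e) (*-comm q′ p′)))
              }
            ; assoc   = λ p q s → ≡⇒≋ (*-assoc p q s)
            }
          ; identity = (λ p → ≡⇒≋ (*-identityˡ p))
                     , λ p → ≋.trans (*-comm p 1ₚ) (≡⇒≋ (*-identityˡ p))
          }
        ; comm = *-comm
        }
      ; distribʳ = λ s p q → ≡⇒≋ (*-distribʳ-+ s p q)
      ; zeroˡ    = λ _ → ≋.refl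
      }
    }

open PolySemiring using (_≋_; coeffs; coeff≡; ≡⇒≋; module ≋; polySemiring)
open CommutativeSemiring polySemiring
  using (+-cong; +-congˡ; +-identityʳ; *-congʳ; *-identityˡ; zeroˡ; semiring)
open import Algebra.Properties.Semiring.Sum semiring using (sum-cong-≋)
open import Algebra.Properties.Semiring.Mult semiring using () renaming (_×_ to _×ₙ_)
open ClosedWalks polySemiring

-- The trace formula for polynomial matrices

five≋ : five ≋ 5 ×ₙ 1ₚ
-- The split on exponents lets the comparisons in `coeff` compute; what remains is closed rational
-- arithmetic.
five≋ = coeffs λ where
  zero    zero    → ≡.refl
  zero    (suc _) → ≡.refl
  (suc _) _       → ≡.refl

tenth-ten : tenth * (10 ×ₙ 1ₚ) ≋ 1ₚ
tenth-ten = coeffs λ where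
  zero    zero    → ≡.refl
  zero    (suc _) → ≡.refl
  (suc _) _       → ≡.refl

minusOne : Poly
minusOne = const (ℚ.- 1ℚ)

minusOne+1 : minusOne + 1ₚ ≋ 0ₚ
minusOne+1 = coeffs λ where
  zero    zero    → ≡.refl
  zero    (suc _) → ≡.refl
  (suc _) _       → ≡.refl

module _ {n : ℕ} (M : Matrix n) where

  𝟙≋ : ∀ (i j : Fin n) → 𝟙 i j ≋ [ j ≟ i ]
  𝟙≋ i j with i ≟ j
  ... | yes i≡j = ≋.sym ([]-yes (j ≟ i) (≡.sym i≡j))
  ... | no  i≢j = ≋.sym ([]-no (j ≟ i) (≢-sym i≢j))

  Δ≋ : ∀ i j → Δ M i j ≋ [ i ≟ j ] * ∑ λ k → M i k ^ 2
  Δ≋ i j with i ≟ j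
  ... | yes _ = ≋.sym (*-identityˡ _)
  ... | no  _ = ≋.sym (zeroˡ (∑ λ k → M i k ^ 2))

  module _ (symmetric : ∀ i j → M i j ≋ M j i) (loopless : ∀ i → M i i ≋ 0ₚ) where

    Φ₅-≋ : Φ₅ M ≋ ∑⁵ (normalised M symmetric loopless)
    Φ₅-≋ = trace-formula M symmetric loopless 𝟙 𝟙≋ (Δ M) Δ≋ five minusOne tenth five≋ minusOne+1 tenth-ten

    Φ₅≋entries : Φ₅ M ≋ Φ₅-entries M
    Φ₅≋entries = trace-formula-entries M symmetric loopless 𝟙 𝟙≋ (Δ M) Δ≋ five minusOne tenth

-- From the list of cycles to a fivefold sum

sumₚ-++ : ∀ ps qs → sumₚ (ps ++ qs) ≋ sumₚ ps + sumₚ qs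
sumₚ-++ []       qs = ≋.refl
sumₚ-++ (p ∷ ps) qs = ≋.trans (+-congˡ {p} (sumₚ-++ ps qs))
  (≡⇒≋ (≡.sym (++-assoc p (sumₚ ps) (sumₚ qs))))

sumₚ-filter : ∀ {A : Set} {P : Pred A 0ℓ} (P? : Decidable P) (f : A → Poly) xs →
  sumₚ (List.map f (List.filter P? xs)) ≋ sumₚ (List.map (λ x → [ P? x ] * f x) xs)
sumₚ-filter P? f []       = ≋.refl
sumₚ-filter P? f (x ∷ xs) with P? x
... | yes _ = +-cong (≋.sym (*-identityˡ (f x))) (sumₚ-filter P? f xs)
... | no  _ = +-cong (≋.sym (zeroˡ (f x))) (sumₚ-filter P? f xs)

sumₚ-product : ∀ {A B : Set} {n} (f : B → Poly) (g : Fin n → A → B) ys →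
  sumₚ (List.map f (List.cartesianProductWith g (List.allFin n) ys)) ≋
  ∑ λ v → sumₚ (List.map (f ∘ g v) ys)
sumₚ-product f g ys = along id
  where
  -- `allFin n` is `tabulate id`; the induction needs a general `h`, because the tail of a
  -- tabulation precomposes it with `suc`.
  along : ∀ {k} (h : Fin k → Fin _) →
    sumₚ (List.map f (List.cartesianProductWith g (List.tabulate h) ys)) ≋
    ∑ λ v → sumₚ (List.map (f ∘ g (h v)) ys)
  along {zero}  h = ≋.refl
  along {suc k} h = ≋.trans
    (≡⇒≋ (≡.cong sumₚ (map-++ f (List.map (g (h zero)) ys) _)))
    (≋.trans (sumₚ-++ (List.map f (List.map (g (h zero)) ys)) _)
      (+-cong (≡⇒≋ (≡.cong sumₚ (≡.sym (map-∘ ys)))) (along (h ∘ suc))))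

module _ (G : WeightedGraph) where
  open WeightedGraph G

  sumₚ-sequences : ∀ i (f : Vec (Fin order) (suc i) → Poly) →
    sumₚ (List.map f (sequences G (suc i))) ≋ ∑ λ v → sumₚ (List.map (f ∘ (v ∷_)) (sequences G i))
  sumₚ-sequences i f = sumₚ-product f _∷_ (sequences G i)

  sumₚ-sequences₅ : ∀ (f : Vec (Fin order) 5 → Poly) →
    sumₚ (List.map f (sequences G 5)) ≋ ∑⁵ λ a b c d e → f (a ∷ b ∷ c ∷ d ∷ e ∷ [])
  sumₚ-sequences₅ f =
    ≋.trans (sumₚ-sequences 4 f) (sum-cong-≋ λ a →
    ≋.trans (sumₚ-sequences 3 (f ∘ (a ∷_))) (sum-cong-≋ λ b →
    ≋.trans (sumₚ-sequences 2 (f ∘ (a ∷_) ∘ (b ∷_))) (sum-cong-≋ λ c →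
    ≋.trans (sumₚ-sequences 1 (f ∘ (a ∷_) ∘ (b ∷_) ∘ (c ∷_))) (sum-cong-≋ λ d →
    ≋.trans (sumₚ-sequences 0 (f ∘ (a ∷_) ∘ (b ∷_) ∘ (c ∷_) ∘ (d ∷_))) (sum-cong-≋ λ e →
    +-identityʳ (f (a ∷ b ∷ c ∷ d ∷ e ∷ [])))))))

  symmetric : ∀ u v → adjacencyMatrix u v ≋ adjacencyMatrix v u
  symmetric u v = ≡⇒≋ (≡.cong (fromMaybe 0ₚ) (edge-sym u v))

  zeroDiagonal : ∀ v → adjacencyMatrix v v ≋ 0ₚ
  zeroDiagonal v = ≡⇒≋ (≡.cong (fromMaybe 0ₚ) (loopless v))

  adjacent⇒≢ : ∀ {u v} → Adjacent u v → u ≢ v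
  adjacent⇒≢ {u} adj ≡.refl = ≡.subst (T ∘ is-just) (loopless u) adj

  AllAdjacent : List (Fin order × Fin order) → Set
  AllAdjacent = ListAll.All λ (u , v) → Adjacent u v

  weight-nonadjacent : ∀ {u v} → ¬ Adjacent u v → adjacencyMatrix u v ≋ 0ₚ
  weight-nonadjacent {u} {v} ¬adj with edge u v
  ... | just _  = contradiction _ ¬adj
  ... | nothing = ≋.refl

  product-nonadjacent : ∀ ps → ¬ AllAdjacent ps →
    productₚ (List.map (λ (u , v) → adjacencyMatrix u v) ps) ≋ 0ₚ
  product-nonadjacent []             ¬adj = contradiction [] ¬adj
  product-nonadjacent ((u , v) ∷ ps) ¬adj with T? (is-just (edge u v))
  ... | yes uv = vanish (adjacencyMatrix u v) (product-nonadjacent ps λ adj → ¬adj (uv ∷ adj))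
  ... | no ¬uv = *-congʳ (weight-nonadjacent ¬uv)

  -- Both sides are 0-1 multiples of the same weight. On a cycle all factors are 1; otherwise some
  -- condition fails, and either its bracket or the weight itself is zero.
  cycle-weight : ∀ a b c d e → let vs = a ∷ b ∷ c ∷ d ∷ e ∷ [] in
    [ isCycle? G vs ] * cycleWeight G vs ≋ normalised adjacencyMatrix symmetric zeroDiagonal a b c d e
  cycle-weight a b c d e = by-cases (isCycle? G vs) (least? a b c d e) (b <? e) (spread? a b c d e)
      (ListAll.all? (λ _ → T? _) (sides G vs))
    where
    vs : Vec (Fin order) 5
    vs = a ∷ b ∷ c ∷ d ∷ e ∷ []
    [cycle] W : Poly
    [cycle] = [ isCycle? G vs ]
    W = cycleWeight G vs
    N : Poly
    N = [ least? a b c d e ] * ([ b <? e ] * ([ spread? a b c d e ] * W))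
    isCycle : Least a b c d e → b Fin.< e → Spread a b c d e → AllAdjacent (sides G vs) → IsCycle G vs
    -- Of the ten inequalities five come from adjacency along the sides, the graph having no loops,
    -- and five from `Spread`.
    isCycle (ab , ac , ad , ae) b<e (a≢c , b≢d , c≢e , d≢a , e≢b) adj@(a~b ∷ b~c ∷ c~d ∷ d~e ∷ e~a ∷ []) =
      ( (adjacent⇒≢ a~b ∷ a≢c ∷ ≢-sym d≢a ∷ ≢-sym (adjacent⇒≢ e~a) ∷ [])
      ∷ (adjacent⇒≢ b~c ∷ b≢d ∷ ≢-sym e≢b ∷ []) ∷ (adjacent⇒≢ c~d ∷ c≢e ∷ [])
      ∷ (adjacent⇒≢ d~e ∷ []) ∷ [] ∷ [])
      , adj , (ab ∷ ac ∷ ad ∷ ae ∷ []) , b<e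
    isCycle⁻ : IsCycle G vs → Least a b c d e × b Fin.< e × Spread a b c d e
    isCycle⁻ (((_ ∷ ac ∷ ad ∷ _ ∷ []) ∷ (_ ∷ bd ∷ be ∷ []) ∷ (_ ∷ ce ∷ []) ∷ _) , _
             , (a<b ∷ a<c ∷ a<d ∷ a<e ∷ []) , b<e) =
      (a<b , a<c , a<d , a<e) , b<e , (ac , bd , ce , ≢-sym ad , ≢-sym be)
    zero-when : ¬ IsCycle G vs → N ≋ 0ₚ → [cycle] * W ≋ N
    zero-when ¬cyc N≋0 = ≋.trans (*-congʳ ([]-no (isCycle? G vs) ¬cyc)) (≋.sym N≋0)
    by-cases : Dec (IsCycle G vs) → Dec (Least a b c d e) → Dec (b Fin.< e) → Dec (Spread a b c d e) →
      Dec (AllAdjacent (sides G vs)) → [cycle] * W ≋ N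
    by-cases (yes cyc) _ _ _ _ = let (least , b<e , spread) = isCycle⁻ cyc in
      ≋.trans ([]-absorb (isCycle? G vs) (contradiction cyc))
      (≋.sym (≋.trans ([]-absorb (least? a b c d e) (contradiction least))
      (≋.trans ([]-absorb (b <? e) (contradiction b<e)) ([]-absorb (spread? a b c d e) (contradiction spread)))))
    by-cases (no ¬cyc) (no ¬least) _ _ _ =
      zero-when ¬cyc (*-congʳ ([]-no (least? a b c d e) ¬least))
    by-cases (no ¬cyc) (yes _) (no b≮e) _ _ =
      zero-when ¬cyc (vanish [ least? a b c d e ] (*-congʳ ([]-no (b <? e) b≮e)))
    by-cases (no ¬cyc) (yes _) (yes _) (no ¬spread) _ =
      zero-when ¬cyc (vanish [ least? a b c d e ] (vanish [ b <? e ]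
        (*-congʳ ([]-no (spread? a b c d e) ¬spread))))
    -- All brackets of `N` are 1 here; a missing side has weight `0ₚ` and annihilates `W`.
    by-cases (no ¬cyc) (yes _) (yes _) (yes _) (no ¬adj) =
      zero-when ¬cyc (vanish [ least? a b c d e ] (vanish [ b <? e ] (vanish [ spread? a b c d e ]
        (product-nonadjacent (sides G vs) ¬adj))))
    by-cases (no ¬cyc) (yes least) (yes b<e) (yes spread) (yes adj) =
      contradiction (isCycle least b<e spread adj) ¬cyc

  cyclePolynomial₅ : cyclePolynomial G 5 ≋ Φ₅ adjacencyMatrix
  cyclePolynomial₅ =
    ≋.trans (sumₚ-filter (isCycle? G) (cycleWeight G) (sequences G 5))
    (≋.trans (sumₚ-sequences₅ (λ vs → [ isCycle? G vs ] * cycleWeight G vs))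
    (≋.trans (∑⁵-cong cycle-weight)
    (≋.sym (Φ₅-≋ adjacencyMatrix symmetric zeroDiagonal))))

theorem6p5 : ((D : ReducedAlternatingDiagram) (black : Height) →
    let white = flip black
        A_B = WeightedGraph.adjacencyMatrix (taitGraph* D black)
        A_W = WeightedGraph.adjacencyMatrix (taitGraph* D white)
    in CWR D black 5 ≈₂ (Φ₅ A_B , Φ₅ A_W))
    × ((n : ℕ) (M : Matrix n) → Symmetric M → ZeroDiagonal M → Φ₅ M ≈ Φ₅-entries M)
theorem6p5 =
  (λ D black → coeff≡ (cyclePolynomial₅ (taitGraph* D black))
             , coeff≡ (cyclePolynomial₅ (taitGraph* D (flip black)))) ,
  λ n M sym diag → coeff≡
    (Φ₅≋entries M (λ i j → coeffs (sym i j)) (λ i → coeffs (diag i)))
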